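{- Let $G$ be a graph of order $n$. Then $\lambda(G)=0$ if and only if $G=K_n$ or $G=\overline{K_n}$.
   Context: Graphs are finite, simple (no loops or multiple edges), undirected; $n=|V(G)|$ is the order of $G$ (at least 1). $K_n$ is the complete graph and $\overline{K_n}$ the edgeless graph on $n$ vertices. Standard zero forcing: a subset $S\subseteq V(G)$ is colored blue and all other vertices white. Standard color change rule: if a blue vertex has exactly one white neighbor, then that white neighbor becomes blue. $S$ is a zero forcing set if repeated application of the rule eventually turns all vertices blue. The zero forcing span $\lambda(G)$ is the number of distinct cardinalities $k$ for which there exist $Z,F\subseteq V(G)$ with $|Z|=|F|=k$ such that $Z$ is a zero forcing set and $F$ is not a zero forcing set. -}

module Defs where

open import Level using (0ℓ)
open import Data.Empty using (⊥)
open import Data.Fin.Base using (Fin)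
open import Data.Fin.Properties using (any?; all?; _≟_)
open import Data.Fin.Subset using (Subset; ⊤; _∈_; _∉_; _∪_; ⁅_⁆; ∣_∣; _⊃_)
open import Data.Fin.Subset.Induction using (⊃-wellFounded)
open import Data.Fin.Subset.Properties
  using (_∈?_; anySubset?; p⊆p∪q; q⊆p∪q; x∈⁅x⁆)
open import Data.Bool.Properties using () renaming (_≟_ to _≟ᵇ_)
open import Data.Vec.Properties using (≡-dec)
open import Data.List.Base using (filter; length; upTo)
open import Data.Nat.Base using (ℕ; suc)
open import Data.Nat.Properties using () renaming (_≟_ to _≟ⁿ_)
open import Data.Product.Base using (∃; ∃-syntax; _×_; _,_)
open import Data.Sum.Base using (_⊎_; inj₁; inj₂)
open import Function.Bundles using (_↔_; _⇔_; module Inverse)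
open import Induction.WellFounded using (Acc; acc)
open import Relation.Binary.Core using (Rel)
open import Relation.Binary.Construct.Closure.ReflexiveTransitive using (Star; ε; _◅_)
open import Relation.Binary.Definitions using (Decidable; Symmetric)
open import Relation.Binary.PropositionalEquality using (_≡_; _≢_; refl; ≢-sym)
open import Relation.Nullary using (¬_; Dec; yes; no)
open import Relation.Nullary.Decidable using (map′; ¬?; _×-dec_; _⊎-dec_; _→-dec_)

record Graph (n : ℕ) : Set₁ where
  field
    Adj    : Rel (Fin n) 0ℓ
    adj?   : Decidable Adj
    sym    : Symmetric Adj
    irrefl : ∀ {u} → ¬ Adj u u

K : ∀ n → Graph n
K n = record
  { Adj    = _≢_
  ; adj?   = λ u v → ¬? (u ≟ v)
  ; sym    = ≢-sym
  ; irrefl = λ u≢u → u≢u refl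
  }

edgeless : ∀ n → Graph n
edgeless n = record
  { Adj    = λ _ _ → ⊥
  ; adj?   = λ _ _ → no λ ()
  ; sym    = λ ()
  ; irrefl = λ ()
  }

infix 4 _≅_

record _≅_ {m n} (G : Graph m) (H : Graph n) : Set where
  private
    module G = Graph G
    module H = Graph H
  field
    bijection : Fin m ↔ Fin n
  open Inverse bijection using (to)
  field
    preserves : ∀ u v → G.Adj u v ⇔ H.Adj (to u) (to v)

module _ {n} (G : Graph n) where
  open Graph G

  -- With blue set B, u is blue and w is its only white neighbour.
  Forces : Subset n → Fin n → Fin n → Set
  Forces B u w =
    u ∈ B × (Adj u w × w ∉ B) × (∀ v → Adj u v × v ∉ B → v ≡ w)

  data Step (B : Subset n) : Subset n → Set where
    force : ∀ {u w} → Forces B u w → Step B (B ∪ ⁅ w ⁆)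

  -- A force that is available stays available until its target is blue, so
  -- the order in which forces are performed does not affect the final set.
  ZeroForcing : Subset n → Set
  ZeroForcing S = Star Step S ⊤

  Mixed : ℕ → Set
  Mixed k = ∃[ Z ] ∃[ F ] ∣ Z ∣ ≡ k × ∣ F ∣ ≡ k × ZeroForcing Z × ¬ ZeroForcing F

  forces? : ∀ B u w → Dec (Forces B u w)
  forces? B u w =
    u ∈? B ×-dec white? w ×-dec all? (λ v → white? v →-dec (v ≟ w))
    where
    white? : ∀ v → Dec (Adj u v × v ∉ B)
    white? v = adj? u v ×-dec ¬? (v ∈? B)

  private
    grows : ∀ {B u w} → Forces B u w → (B ∪ ⁅ w ⁆) ⊃ B
    grows {B} {w = w} (_ , (_ , w∉B) , _) =
      p⊆p∪q ⁅ w ⁆ , w , q⊆p∪q B ⁅ w ⁆ (x∈⁅x⁆ w) , w∉B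

    zeroForcing?′ : ∀ S → Acc _⊃_ S → Dec (ZeroForcing S)
    zeroForcing?′ S (acc rec) = map′ join split
      (≡-dec _≟ᵇ_ S ⊤ ⊎-dec any? λ u → any? λ w → next? u w)
      where
      Next : Fin n → Fin n → Set
      Next u w = Forces S u w × ZeroForcing (S ∪ ⁅ w ⁆)

      next? : ∀ u w → Dec (Next u w)
      next? u w with forces? S u w
      ... | no ¬f = no λ (f , _) → ¬f f
      ... | yes f = map′ (f ,_) (λ (_ , z) → z)
                          (zeroForcing?′ (S ∪ ⁅ w ⁆) (rec (grows f)))

      join : S ≡ ⊤ ⊎ ∃ (λ u → ∃ (Next u)) → ZeroForcing S
      join (inj₁ refl)              = ε
      join (inj₂ (_ , _ , f , run)) = force f ◅ run

      split : ZeroForcing S → S ≡ ⊤ ⊎ ∃ (λ u → ∃ (Next u))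
      split ε               = inj₁ refl
      split (force f ◅ run) = inj₂ (_ , _ , f , run)

  zeroForcing? : ∀ S → Dec (ZeroForcing S)
  zeroForcing? S = zeroForcing?′ S (⊃-wellFounded S)

  mixed? : ∀ k → Dec (Mixed k)
  mixed? k = anySubset? λ Z → anySubset? λ F →
    (∣ Z ∣ ≟ⁿ k) ×-dec (∣ F ∣ ≟ⁿ k) ×-dec zeroForcing? Z ×-dec ¬? (zeroForcing? F)

  -- Subsets of Fin n have at most n elements, so 0 , … , n are the only
  -- candidate cardinalities.
  zeroForcingSpan : ℕ
  zeroForcingSpan = length (filter mixed? (upTo (suc n)))

{-# OPTIONS --safe #-}
-- If λ(G) = 0, let k > 0 be such that some k-set forces but no (k-1)-set does;
-- then every k-set forces.  So a non-isolated vertex v has a closed neighbourhood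
-- N[v] of more than k vertices: otherwise a k-set containing N[v] could drop a
-- neighbour of v, which v would force at once.  If k = n, all vertices are
-- isolated.  If k < n, the first force u → w from a k-set S then gives
-- N[u] = S ∪ {w}.  Should N[u] ≠ V, apply this to k-sets close to N[u].
-- First, N[u] - u yields a twin c with N[c] = N[u].  Next, for every z ∉ N[u],
-- replacing u, c by z shows that z is adjacent to all of N[u] except u and c, and
-- has another neighbour q ∉ N[u].  Finally N[u] performs a force, say y → z, and
-- in the k-set (N[u] - c - y) ∪ {z} the forcing vertex would have the two white
-- neighbours c and q.  Hence N[u] = V and k = n - 1, so G is complete.
module Submission where

open import Defs
open import Level using (0ℓ)
open import Data.Empty using (⊥-elim)
open import Data.Fin.Base using (Fin; zero; suc)
open import Data.Fin.Properties using (any?; _≟_)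
open import Data.Fin.Subset
  using (Subset; inside; outside; ⊤; ⊥; _∈_; _∉_; _⊆_; _∪_; _-_; ⁅_⁆; ∣_∣)
open import Data.Fin.Subset.Properties
open import Data.List.Base using (List; []; filter; length; upTo)
open import Data.List.Membership.Propositional using () renaming (_∈_ to _∈ˡ_)
open import Data.List.Membership.Propositional.Properties using (∈-filter⁺; ∈-upTo⁺)
open import Data.List.Properties using (filter-none)
open import Data.List.Relation.Unary.All using (universal)
open import Data.Nat.Base using (ℕ; zero; suc; NonZero; ≢-nonZero⁻¹; _≤_; _<_; s≤s; z≤n)
open import Data.Nat.Properties
  using (m<n⇒m<1+n; ≤-reflexive; ≤-trans; ≤-antisym; <-irrefl; <⇒≢; ≰⇒>; m≤n⇒m<n∨m≡n;
    suc-injective) renaming (_≟_ to _≟ⁿ_)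
open import Data.Product.Base using (∃; ∃-syntax; _×_; _,_; proj₁)
open import Data.Sum.Base as Sum using (_⊎_; inj₁; inj₂; [_,_]′)
open import Data.Vec.Base using ([]; _∷_; here; there; tabulate)
open import Data.Vec.Properties using (lookup⇒[]=; []=⇒lookup; lookup∘tabulate)
open import Function.Base using (_∘_; id; case_of_)
open import Function.Bundles using (_⇔_; mk⇔; module Equivalence; module Injection)
open import Function.Construct.Identity using (↔-id)
open import Function.Properties.Inverse using (Inverse⇒Injection)
open import Relation.Binary.Construct.Closure.ReflexiveTransitive using (ε; _◅_)
open import Relation.Binary.PropositionalEquality
  using (_≡_; _≢_; refl; sym; trans; cong; subst)
open import Relation.Nullary using (¬_; yes; no; does; contradiction)
open import Relation.Nullary.Decidable
  using (¬?; _×-dec_; _⊎-dec_; dec-true; dec-false; decidable-stable)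
open import Relation.Unary using (Pred; Decidable)

private variable
  n j : ℕ
  p q : Subset n
  x y : Fin n

-- Adding, removing and exchanging elements of finite subsets.

∈-∪⁅⁆⁻ : x ∈ p ∪ ⁅ y ⁆ → x ∈ p ⊎ x ≡ y
∈-∪⁅⁆⁻ {p = p} {y = y} x∈ = [ inj₁ , inj₂ ∘ x∈⁅y⁆⇒x≡y y ]′ (x∈p∪q⁻ p ⁅ y ⁆ x∈)

∈-∪⁅⁆ˡ : x ∈ p → x ∈ p ∪ ⁅ y ⁆
∈-∪⁅⁆ˡ {y = y} = p⊆p∪q ⁅ y ⁆

∈-∪⁅⁆ʳ : x ∈ p ∪ ⁅ x ⁆
∈-∪⁅⁆ʳ {x = x} {p = p} = q⊆p∪q p ⁅ x ⁆ (x∈⁅x⁆ x)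

∪⁅⁆⊆ : p ⊆ q → y ∈ q → p ∪ ⁅ y ⁆ ⊆ q
∪⁅⁆⊆ p⊆q y∈q x∈ with ∈-∪⁅⁆⁻ x∈
... | inj₁ x∈p  = p⊆q x∈p
... | inj₂ refl = y∈q

x∉p-x : x ∉ p - x
x∉p-x {x = zero}  {p = inside ∷ p} ()
x∉p-x {x = zero}  {p = outside ∷ p} ()
x∉p-x {x = suc x} {p = s ∷ p} (there x∈) = x∉p-x {x = x} {p = p} x∈

∈-minus⁻ : x ∈ p - y → x ∈ p × x ≢ y
∈-minus⁻ {p = p} {y = y} x∈ = p─q⊆p p ⁅ y ⁆ x∈ , λ { refl → x∉p-x {p = p} x∈ }

p-x∪x≡p : x ∈ p → (p - x) ∪ ⁅ x ⁆ ≡ p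
p-x∪x≡p {x = x} {p = p} x∈p = ⊆-antisym (∪⁅⁆⊆ (p─q⊆p p ⁅ x ⁆) x∈p) back
  where
  back : p ⊆ (p - x) ∪ ⁅ x ⁆
  back {y} y∈p with y ≟ x
  ... | yes refl = ∈-∪⁅⁆ʳ
  ... | no y≢x   = ∈-∪⁅⁆ˡ (x∈p∧x≢y⇒x∈p-y y∈p y≢x)

∣p∪⁅x⁆∣≡1+∣p∣ : x ∉ p → ∣ p ∪ ⁅ x ⁆ ∣ ≡ suc ∣ p ∣
∣p∪⁅x⁆∣≡1+∣p∣ {x = zero}  {p = inside ∷ p}  x∉p = contradiction here x∉p
∣p∪⁅x⁆∣≡1+∣p∣ {x = zero}  {p = outside ∷ p} x∉p =
  cong (suc ∘ ∣_∣) (⊆-antisym ([ id , ⊥-elim ∘ ∉⊥ ]′ ∘ x∈p∪q⁻ p ⊥) (p⊆p∪q ⊥))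
∣p∪⁅x⁆∣≡1+∣p∣ {x = suc x} {p = inside ∷ p}  x∉p = cong suc (∣p∪⁅x⁆∣≡1+∣p∣ (x∉p ∘ there))
∣p∪⁅x⁆∣≡1+∣p∣ {x = suc x} {p = outside ∷ p} x∉p = ∣p∪⁅x⁆∣≡1+∣p∣ (x∉p ∘ there)

∣p∣≡1+∣p-x∣ : x ∈ p → ∣ p ∣ ≡ suc ∣ p - x ∣
∣p∣≡1+∣p-x∣ {p = p} x∈p =
  trans (cong ∣_∣ (sym (p-x∪x≡p x∈p))) (∣p∪⁅x⁆∣≡1+∣p∣ (x∉p-x {p = p}))

∣p-x∣≡ : x ∈ p → ∣ p ∣ ≡ suc j → ∣ p - x ∣ ≡ j
∣p-x∣≡ x∈p eq = suc-injective (trans (sym (∣p∣≡1+∣p-x∣ x∈p)) eq)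

-- `p` will be a closed neighbourhood, one vertex above the threshold size `suc j`; two vertices out
-- and one in bring it back to that size.
exchange-size : ∀ {x y z} → x ∈ p → y ∈ p → y ≢ x → z ∉ p → ∣ p ∣ ≡ suc (suc j) →
  ∣ (p - x - y) ∪ ⁅ z ⁆ ∣ ≡ suc j
exchange-size {p = p} {x = x} x∈p y∈p y≢x z∉p ∣p∣ = trans
  (∣p∪⁅x⁆∣≡1+∣p∣ (z∉p ∘ proj₁ ∘ ∈-minus⁻ {p = p} ∘ proj₁ ∘ ∈-minus⁻ {p = p - x}))
  (cong suc (∣p-x∣≡ (x∈p∧x≢y⇒x∈p-y y∈p y≢x) (∣p-x∣≡ x∈p ∣p∣)))

⊆∧∣≥∣⇒≡ : p ⊆ q → ∣ q ∣ ≤ ∣ p ∣ → p ≡ q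
⊆∧∣≥∣⇒≡ {p = p} {q = q} p⊆q ∣q∣≤∣p∣ = ⊆-antisym p⊆q λ {x} x∈q →
  decidable-stable (x ∈? p) λ x∉p →
    <-irrefl refl (≤-trans (p⊂q⇒∣p∣<∣q∣ (p⊆q , x , x∈q , x∉p)) ∣q∣≤∣p∣)

≡⊤⊎∃∉ : (p : Subset n) → p ≡ ⊤ ⊎ ∃ (_∉ p)
≡⊤⊎∃∉ p with any? (λ x → ¬? (x ∈? p))
... | yes missing = inj₂ missing
... | no ¬missing = inj₁ (⊆-antisym ⊆⊤ λ {x} _ →
  decidable-stable (x ∈? p) λ x∉p → ¬missing (x , x∉p))

superset-of-size : (p : Subset n) {k : ℕ} → ∣ p ∣ ≤ k → k ≤ n → ∃[ q ] p ⊆ q × ∣ q ∣ ≡ k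
superset-of-size [] {zero} _ _ = [] , id , refl
superset-of-size (inside ∷ p) {suc k} (s≤s ≤k) (s≤s k≤n) =
  let q , p⊆q , ∣q∣ = superset-of-size p ≤k k≤n in inside ∷ q , s⊆s p⊆q , cong suc ∣q∣
superset-of-size {suc n} (outside ∷ p) {k} ≤k k≤1+n with m≤n⇒m<n∨m≡n k≤1+n
... | inj₁ (s≤s k≤n) =
  let q , p⊆q , ∣q∣ = superset-of-size p ≤k k≤n in outside ∷ q , s⊆s p⊆q , ∣q∣
-- `k` is now the whole length, so the first element can no longer be left out.
... | inj₂ refl = ⊤ , ⊆⊤ , ∣⊤∣≡n (suc n)

-- Descends from `n` to the first failure of `P`. With `P k` read as "some set of size `k` forces",
-- this supplies the threshold size.
first-jump : {P : Pred ℕ 0ℓ} → Decidable P → ¬ P 0 → ∀ n → P n →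
  ∃[ k ] k < n × ¬ P k × P (suc k)
first-jump P? ¬P0 zero    Pn = contradiction Pn ¬P0
first-jump P? ¬P0 (suc n) Pn with P? n
... | no ¬P = n , ≤-reflexive refl , ¬P , Pn
... | yes P = let k , k<n , rest = first-jump P? ¬P0 n P in k , m<n⇒m<1+n k<n , rest

-- Mixed sizes, forcing from larger sets, closed neighbourhoods.

module _ (G : Graph n) where
  open Graph G renaming (sym to Adj-sym)

  span≡0⇒¬Mixed : zeroForcingSpan G ≡ 0 → ∀ k → ¬ Mixed G k
  span≡0⇒¬Mixed span≡0 k mixed@(Z , _ , refl , _) =
    empty span≡0 (∈-filter⁺ (mixed? G) (∈-upTo⁺ (s≤s (∣p∣≤n Z))) mixed)
    where
    empty : ∀ {xs : List ℕ} → length xs ≡ 0 → ¬ k ∈ˡ xs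
    empty {[]} _ ()

  ¬Mixed⇒span≡0 : (∀ k → ¬ Mixed G k) → zeroForcingSpan G ≡ 0
  ¬Mixed⇒span≡0 ¬mixed = cong length (filter-none (mixed? G) (universal ¬mixed (upTo (suc n))))

  -- Along the run from `S`, targets already in `X` are skipped, which keeps the blue set inside
  -- `X`. The first target outside `X` can be forced from `X` too, because a larger blue set gives
  -- the forcing vertex no new white neighbours.
  ZeroForcing⊆⇒⊤⊎Forces : ∀ {S X} → ZeroForcing G S → S ⊆ X →
    X ≡ ⊤ ⊎ (∃[ u ] ∃[ w ] Forces G X u w)
  ZeroForcing⊆⇒⊤⊎Forces ε ⊤⊆X = inj₁ (⊆-antisym ⊆⊤ ⊤⊆X)
  ZeroForcing⊆⇒⊤⊎Forces {X = X} (force {u} {w} (u∈S , (uw , _) , only) ◅ run) S⊆X with w ∈? X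
  ... | yes w∈X = ZeroForcing⊆⇒⊤⊎Forces run (∪⁅⁆⊆ S⊆X w∈X)
  ... | no w∉X  = inj₂ (u , w , S⊆X u∈S , (uw , w∉X) , λ v (uv , v∉X) → only v (uv , v∉X ∘ S⊆X))

  N[_] : Fin n → Subset n
  N[ u ] = tabulate λ v → does (u ≟ v ⊎-dec adj? u v)

  ∈N⁺ : ∀ {u v} → u ≡ v ⊎ Adj u v → v ∈ N[ u ]
  ∈N⁺ {u} {v} h = lookup⇒[]= v N[ u ]
    (trans (lookup∘tabulate _ v) (dec-true (u ≟ v ⊎-dec adj? u v) h))

  ∈N⁻ : ∀ {u v} → v ∈ N[ u ] → u ≡ v ⊎ Adj u v
  ∈N⁻ {u} {v} v∈ = decidable-stable (u ≟ v ⊎-dec adj? u v) λ ¬h →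
    case trans (sym (dec-false (u ≟ v ⊎-dec adj? u v) ¬h))
               (trans (sym (lookup∘tabulate _ v)) ([]=⇒lookup v∈)) of λ ()

  N-refl : ∀ {u} → u ∈ N[ u ]
  N-refl = ∈N⁺ (inj₁ refl)

  N-sym : ∀ {u v} → v ∈ N[ u ] → u ∈ N[ v ]
  N-sym v∈ with ∈N⁻ v∈
  ... | inj₁ refl = v∈
  ... | inj₂ uv   = ∈N⁺ (inj₂ (Adj-sym uv))

  -- Here k = suc j is a size where zero forcing is all-or-nothing.
  module Threshold (1+j≤n : suc j ≤ n)
                   (all-force : ∀ S → ∣ S ∣ ≡ suc j → ZeroForcing G S)
                   (none-force : ∀ S → ∣ S ∣ ≡ j → ¬ ZeroForcing G S) where

    ∣N∣> : ∀ {v w} → Adj v w → suc j < ∣ N[ v ] ∣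
    ∣N∣> {v} {w} vw = ≰⇒> λ ∣N∣≤ →
      let S , N⊆S , ∣S∣ = superset-of-size N[ v ] ∣N∣≤ 1+j≤n
          w∈S = N⊆S (∈N⁺ (inj₂ vw))
          v∈S-w = x∈p∧x≢y⇒x∈p-y (N⊆S N-refl) λ { refl → irrefl vw }
          only = λ x (vx , x∉) → decidable-stable (x ≟ w) λ x≢w →
            x∉ (x∈p∧x≢y⇒x∈p-y (N⊆S (∈N⁺ (inj₂ vx))) x≢w)
      in none-force (S - w) (∣p-x∣≡ w∈S ∣S∣)
           (force (v∈S-w , (vw , x∉p-x {p = S}) , only)
            ◅ subst (ZeroForcing G) (sym (p-x∪x≡p w∈S)) (all-force S ∣S∣))

    -- What the first force from a set of threshold size looks like. The contradictions below come
    -- from `N∖S⇒≡w`: `N[ u ]` cannot have two distinct vertices outside `S`.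
    record Dominated (S : Subset n) : Set where
      constructor dominated
      field
        {u w} : Fin n
        u∈S   : u ∈ S
        w∉S   : w ∉ S
        N≡    : S ∪ ⁅ w ⁆ ≡ N[ u ]

      S⊆N : S ⊆ N[ u ]
      S⊆N x∈S = subst (_ ∈_) N≡ (∈-∪⁅⁆ˡ x∈S)

      w∈N : w ∈ N[ u ]
      w∈N = subst (w ∈_) N≡ ∈-∪⁅⁆ʳ

      N∖S⇒≡w : x ∈ N[ u ] → x ∉ S → x ≡ w
      N∖S⇒≡w x∈N x∉S with ∈-∪⁅⁆⁻ (subst (_ ∈_) (sym N≡) x∈N)
      ... | inj₁ x∈S = contradiction x∈S x∉S
      ... | inj₂ x≡w = x≡w

      ∣N∣≡ : ∣ N[ u ] ∣ ≡ suc ∣ S ∣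
      ∣N∣≡ = trans (cong ∣_∣ (sym N≡)) (∣p∪⁅x⁆∣≡1+∣p∣ w∉S)

    -- As `w` is the only white neighbour of `u`, `N[ u ]` lies in `S ∪ ⁅ w ⁆`; by `∣N∣>` it is too
    -- large to be a proper subset.
    dominate : suc j < n → ∀ S → ∣ S ∣ ≡ suc j → Dominated S
    dominate 1+j<n S ∣S∣ with all-force S ∣S∣
    ... | ε = contradiction (trans (sym ∣S∣) (∣⊤∣≡n n)) (<⇒≢ 1+j<n)
    ... | force {u} {w} (u∈S , (uw , w∉S) , only) ◅ _ =
      dominated u∈S w∉S (sym (⊆∧∣≥∣⇒≡ N⊆ ∣S∪w∣≤))
      where
      N⊆ : N[ u ] ⊆ S ∪ ⁅ w ⁆
      N⊆ {x} x∈N with x ∈? S | ∈N⁻ x∈N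
      ... | yes x∈S | _         = ∈-∪⁅⁆ˡ x∈S
      ... | no _    | inj₁ refl = ∈-∪⁅⁆ˡ u∈S
      ... | no x∉S  | inj₂ ux with refl ← only x (ux , x∉S) = ∈-∪⁅⁆ʳ
      ∣S∪w∣≤ : ∣ S ∪ ⁅ w ⁆ ∣ ≤ ∣ N[ u ] ∣
      ∣S∪w∣≤ = ≤-trans (≤-reflexive (trans (∣p∪⁅x⁆∣≡1+∣p∣ w∉S) (cong suc ∣S∣))) (∣N∣> uw)

    -- Threshold size below the order: completeness.

    module _ (1+j<n : suc j < n) where

      -- Let `c` dominate `N[ u ] - u`. By symmetry `u` lies in `N[ c ]`, so it is the one white
      -- vertex there, and adding it back restores `N[ u ]`.
      closed-twin : ∀ {u} → ∣ N[ u ] ∣ ≡ suc (suc j) → ∃[ c ] c ≢ u × N[ c ] ≡ N[ u ]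
      closed-twin {u} ∣N∣ with dominate 1+j<n (N[ u ] - u) (∣p-x∣≡ N-refl ∣N∣)
      ... | d@(dominated {c} {w} c∈ _ N≡)
        with c∈N , c≢u ← ∈-minus⁻ {p = N[ u ]} c∈
        with refl ← Dominated.N∖S⇒≡w d (N-sym c∈N) (x∉p-x {p = N[ u ]})
        = c , c≢u , trans (sym N≡) (p-x∪x≡p N-refl)

      module _ {u c} (∣N∣ : ∣ N[ u ] ∣ ≡ suc (suc j)) (c≢u : c ≢ u) (Nc≡Nu : N[ c ] ≡ N[ u ]) where

        c∈N : c ∈ N[ u ]
        c∈N = subst (c ∈_) Nc≡Nu N-refl

        OutsideNeighbourhood : Fin n → Set
        OutsideNeighbourhood z =
          (∀ {t} → t ∈ N[ u ] → t ≢ u → t ≢ c → t ∈ N[ z ]) × (∃[ q ] q ∉ N[ u ] × q ≢ z)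

        -- Let `t` dominate the set in which `z` replaces `u` and `c`. A `t` from `N[ u ]` would
        -- have both twins as white neighbours, so `t` is `z`.
        outside-neighbourhood : ∀ {z} → z ∉ N[ u ] → OutsideNeighbourhood z
        outside-neighbourhood {z} z∉N
          with dominate 1+j<n ((N[ u ] - u - c) ∪ ⁅ z ⁆) (exchange-size N-refl c∈N c≢u z∉N ∣N∣)
        ... | d@(dominated {t} {w} t∈T w∉T N≡) = go (∈-∪⁅⁆⁻ t∈T)
          where
          open Dominated d using (S⊆N; w∈N; N∖S⇒≡w)
          T⁺ : ∀ {x} → x ∈ N[ u ] → x ≢ u → x ≢ c → x ∈ (N[ u ] - u - c) ∪ ⁅ z ⁆
          T⁺ x∈N x≢u x≢c = ∈-∪⁅⁆ˡ (x∈p∧x≢y⇒x∈p-y (x∈p∧x≢y⇒x∈p-y x∈N x≢u) x≢c)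
          u∉T : u ∉ (N[ u ] - u - c) ∪ ⁅ z ⁆
          u∉T u∈T with ∈-∪⁅⁆⁻ u∈T
          ... | inj₁ u∈   = x∉p-x {p = N[ u ]} (proj₁ (∈-minus⁻ {p = N[ u ] - u} u∈))
          ... | inj₂ refl = z∉N N-refl
          c∉T : c ∉ (N[ u ] - u - c) ∪ ⁅ z ⁆
          c∉T c∈T with ∈-∪⁅⁆⁻ c∈T
          ... | inj₁ c∈   = x∉p-x {p = N[ u ] - u} c∈
          ... | inj₂ refl = z∉N c∈N
          go : t ∈ N[ u ] - u - c ⊎ t ≡ z → OutsideNeighbourhood z
          go (inj₁ t∈) = contradiction
            (trans (N∖S⇒≡w (N-sym (subst (t ∈_) (sym Nc≡Nu) t∈N)) c∉T)
                   (sym (N∖S⇒≡w (N-sym t∈N) u∉T))) c≢u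
            where
            t∈N : t ∈ N[ u ]
            t∈N = proj₁ (∈-minus⁻ {p = N[ u ]} (proj₁ (∈-minus⁻ {p = N[ u ] - u} t∈)))
          -- The witness `q` is the white neighbour `w` of `z`; it is neither twin, since the twins
          -- have no neighbour outside `N[ u ]`.
          go (inj₂ refl) = (λ x∈N x≢u x≢c → S⊆N (T⁺ x∈N x≢u x≢c)) ,
            w , (λ w∈Nu → w∉T (T⁺ w∈Nu w≢u w≢c)) , λ { refl → w∉T t∈T }
            where
            w≢u : w ≢ u
            w≢u refl = z∉N (N-sym w∈N)
            w≢c : w ≢ c
            w≢c refl = z∉N (subst (z ∈_) Nc≡Nu (N-sym w∈N))

        N-full : N[ u ] ≡ ⊤
        N-full with ZeroForcing⊆⇒⊤⊎Forces
          (all-force (N[ u ] - u) (∣p-x∣≡ N-refl ∣N∣)) (p─q⊆p N[ u ] ⁅ u ⁆)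
        ... | inj₁ N≡⊤ = N≡⊤
        ... | inj₂ (y , z , y∈N , (yz , z∉N) , _) = ⊥-elim (impossible (outside-neighbourhood z∉N))
          where
          y≢u : y ≢ u
          y≢u refl = z∉N (∈N⁺ (inj₂ yz))
          y≢c : y ≢ c
          y≢c refl = z∉N (subst (z ∈_) Nc≡Nu (∈N⁺ (inj₂ yz)))
          T : Subset n
          -- `c` is removed to make it white, `y` to return to size `suc j`; since `y` is not `u`,
          -- the vertex `u` stays blue.
          T = (N[ u ] - c - y) ∪ ⁅ z ⁆
          u∈T : u ∈ T
          u∈T = ∈-∪⁅⁆ˡ (x∈p∧x≢y⇒x∈p-y (x∈p∧x≢y⇒x∈p-y N-refl (c≢u ∘ sym)) (y≢u ∘ sym))
          T⁻ : ∀ {x} → x ∈ T → (x ∈ N[ u ] × x ≢ c) ⊎ x ≡ z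
          T⁻ x∈T with ∈-∪⁅⁆⁻ x∈T
          ... | inj₁ x∈  = inj₁ (∈-minus⁻ {p = N[ u ]} (proj₁ (∈-minus⁻ {p = N[ u ] - c} x∈)))
          ... | inj₂ x≡z = inj₂ x≡z
          impossible : ¬ OutsideNeighbourhood z
          impossible (_ , q , q∉N , q≢z)
            with dominate 1+j<n T (exchange-size c∈N y∈N y≢c z∉N ∣N∣)
          ... | d@(dominated {t} t∈T _ _) with T⁻ t∈T
          ...   | inj₂ refl = z∉N (N-sym (Dominated.S⊆N d u∈T))
          -- `t` lies in `N[ c ]` because `c` is a twin of `u`, and in `N[ q ]` by
          -- `outside-neighbourhood` applied to `q`. So `c` and `q` are both the one white vertex,
          -- though only `c` lies in `N[ u ]`.
          ...   | inj₁ (t∈N , t≢c) = q∉N (subst (_∈ N[ u ]) (trans c≡w (sym q≡w)) c∈N)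
            where
            open Dominated d using (S⊆N; N∖S⇒≡w)
            t≢u : t ≢ u
            t≢u refl = z∉N (S⊆N ∈-∪⁅⁆ʳ)
            c≡w : c ≡ _
            c≡w = N∖S⇒≡w (N-sym (subst (t ∈_) (sym Nc≡Nu) t∈N))
              ([ (λ (_ , c≢c) → c≢c refl) , (λ { refl → z∉N c∈N }) ]′ ∘ T⁻)
            q≡w : q ≡ _
            q≡w = N∖S⇒≡w (N-sym (proj₁ (outside-neighbourhood q∉N) t∈N t≢u t≢c))
              ([ q∉N ∘ proj₁ , q≢z ]′ ∘ T⁻)

      2+j≡n : suc (suc j) ≡ n
      2+j≡n
        -- Any set of size `suc j` will do, so one is grown from `⊥`.
        with S , _ , ∣S∣ ← superset-of-size ⊥ (≤-trans (≤-reflexive (∣⊥∣≡0 n)) z≤n) 1+j≤n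
        with dominated {u} u∈S w∉S N≡ ← dominate 1+j<n S ∣S∣
        = trans (sym ∣N∣) (trans (cong ∣_∣ N≡⊤) (∣⊤∣≡n n))
        where
        ∣N∣ : ∣ N[ u ] ∣ ≡ suc (suc j)
        ∣N∣ = trans (Dominated.∣N∣≡ (dominated u∈S w∉S N≡)) (cong suc ∣S∣)
        N≡⊤ : N[ u ] ≡ ⊤
        N≡⊤ = let c , c≢u , Nc≡Nu = closed-twin ∣N∣ in N-full ∣N∣ c≢u Nc≡Nu

      Adj⇒N≡⊤ : ∀ {v w} → Adj v w → N[ v ] ≡ ⊤
      Adj⇒N≡⊤ {v} vw = ∣p∣≡n⇒p≡⊤ (≤-antisym (∣p∣≤n N[ v ])
        (≤-trans (≤-reflexive (sym 2+j≡n)) (∣N∣> vw)))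

      ∉⇒neighbour : ∀ {x} S → ∣ S ∣ ≡ suc j → x ∉ S → ∃[ u ] Adj x u
      ∉⇒neighbour {x} S ∣S∣ x∉S = go (dominate 1+j<n S ∣S∣)
        where
        go : Dominated S → ∃[ u ] Adj x u
        go d@(dominated {u} u∈S _ _) =
          [ (λ { refl → contradiction u∈S x∉S }) , (λ ux → u , Adj-sym ux) ]′
          (∈N⁻ (subst (x ∈_) (sym N≡⊤) ∈⊤))
          where
          N≡⊤ : N[ u ] ≡ ⊤
          N≡⊤ = ∣p∣≡n⇒p≡⊤ (trans (Dominated.∣N∣≡ d) (trans (cong suc ∣S∣) 2+j≡n))

      -- `⊤ - x` has the threshold size, now `n - 1`, so `x` has some neighbour, and `Adj⇒N≡⊤` then
      -- gives it all the others.
      ≢⇒Adj : ∀ {x y} → x ≢ y → Adj x y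
      ≢⇒Adj {x} {y} x≢y =
        let _ , xu = ∉⇒neighbour (⊤ - x)
              (∣p-x∣≡ {p = ⊤ {n}} (∈⊤ {x = x}) (trans (∣⊤∣≡n n) (sym 2+j≡n))) (x∉p-x {p = ⊤ {n}})
        in [ (λ x≡y → contradiction x≡y x≢y) , id ]′
             (∈N⁻ (subst (y ∈_) (sym (Adj⇒N≡⊤ xu)) ∈⊤))

  -- The dichotomy, its converse and the passage to isomorphism.

  Complete : Set
  Complete = ∀ x y → x ≢ y → Adj x y

  Edgeless : Set
  Edgeless = ∀ x y → ¬ Adj x y

  complete-or-edgeless : .{{_ : NonZero n}} → (∀ k → ¬ Mixed G k) →
    Complete ⊎ Edgeless
  complete-or-edgeless ¬mixed = conclude (first-jump forcing? ¬forcing₀ n (⊤ , ∣⊤∣≡n n , ε))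
    where
    Forcing : ℕ → Set
    Forcing k = ∃[ S ] ∣ S ∣ ≡ k × ZeroForcing G S

    forcing? : Decidable Forcing
    forcing? k = anySubset? λ S → (∣ S ∣ ≟ⁿ k) ×-dec zeroForcing? G S

    ¬forcing₀ : ¬ Forcing 0
    -- For `n = 0` the empty set is `⊤` and forces by the empty run; `NonZero n` excludes this.
    ¬forcing₀ (S , ∣S∣≡0 , ε) = ≢-nonZero⁻¹ n (trans (sym (∣⊤∣≡n n)) ∣S∣≡0)
    ¬forcing₀ (S , ∣S∣≡0 , force (u∈S , _) ◅ _) =
      case trans (sym (∣p∣≡1+∣p-x∣ u∈S)) ∣S∣≡0 of λ ()

    conclude : ∃[ k ] k < n × ¬ Forcing k × Forcing (suc k) →
      Complete ⊎ Edgeless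
    conclude (j , j<n , ¬forcing-j , Z , ∣Z∣ , Z-forces) =
      [ (λ 1+j<n → inj₁ λ _ _ → ≢⇒Adj 1+j<n)
      -- With `suc j ≡ n`, an edge would give a closed neighbourhood of more than `n` vertices.
      , (λ 1+j≡n → inj₂ λ x _ xy → <-irrefl 1+j≡n (≤-trans (∣N∣> xy) (∣p∣≤n N[ x ])))
      ]′ (m≤n⇒m<n∨m≡n j<n)
      where
      all-force : ∀ S → ∣ S ∣ ≡ suc j → ZeroForcing G S
      all-force S ∣S∣ = decidable-stable (zeroForcing? G S) λ ¬S-forces →
        ¬mixed (suc j) (Z , S , ∣Z∣ , ∣S∣ , Z-forces , ¬S-forces)
      none-force : ∀ S → ∣ S ∣ ≡ j → ¬ ZeroForcing G S
      none-force S ∣S∣ S-forces = ¬forcing-j (S , ∣S∣ , S-forces)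
      open Threshold j<n all-force none-force

  -- In a complete graph a blue vertex is adjacent to every white one, so a force needs exactly one
  -- white vertex. If `Z` performs one, `F` of the same size also misses a single vertex, which any
  -- vertex of `F` forces.
  complete⇒¬Mixed : Complete → ∀ k → ¬ Mixed G k
  complete⇒¬Mixed complete k (Z , F , ∣Z∣ , ∣F∣ , Z-forces , ¬F-forces) =
    ¬F-forces (F-forces Z-forces)
    where
    F-forces : ZeroForcing G Z → ZeroForcing G F
    F-forces ε = subst (ZeroForcing G)
      (sym (∣p∣≡n⇒p≡⊤ (trans ∣F∣ (trans (sym ∣Z∣) (∣⊤∣≡n n))))) ε
    F-forces (force {u} {w} (u∈Z , (_ , w∉Z) , only) ◅ _) with ≡⊤⊎∃∉ F | nonempty? F
    ... | inj₁ refl    | _ = ε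
    -- An empty `F` is impossible: `Z` has the same size and contains `u`.
    ... | inj₂ _       | no ¬F = case 1+∣Z-u∣≡0 of λ ()
      where
      1+∣Z-u∣≡0 : suc ∣ Z - u ∣ ≡ 0
      1+∣Z-u∣≡0 = trans (sym (∣p∣≡1+∣p-x∣ u∈Z)) (trans ∣Z∣ (trans (sym ∣F∣)
        (trans (cong ∣_∣ (Empty-unique ¬F)) (∣⊥∣≡0 n))))
    ... | inj₂ (x , x∉F) | yes (a , a∈F) =
      force (a∈F , (complete _ _ (λ { refl → x∉F a∈F }) , x∉F) , F-only)
      ◅ subst (ZeroForcing G) (sym F∪x≡⊤) ε
      where
      Z∪w≡⊤ : Z ∪ ⁅ w ⁆ ≡ ⊤
      Z∪w≡⊤ = ⊆-antisym ⊆⊤ λ {v} _ → decidable-stable (v ∈? Z ∪ ⁅ w ⁆) λ v∉ →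
        v∉ (subst (_∈ Z ∪ ⁅ w ⁆)
          (sym (only v (complete _ _ (λ { refl → v∉ (∈-∪⁅⁆ˡ u∈Z) }) , v∉ ∘ ∈-∪⁅⁆ˡ))) ∈-∪⁅⁆ʳ)
      F∪x≡⊤ : F ∪ ⁅ x ⁆ ≡ ⊤
      F∪x≡⊤ = ∣p∣≡n⇒p≡⊤ (trans (∣p∪⁅x⁆∣≡1+∣p∣ x∉F) (trans (cong suc (trans ∣F∣ (sym ∣Z∣)))
        (trans (sym (∣p∪⁅x⁆∣≡1+∣p∣ w∉Z)) (trans (cong ∣_∣ Z∪w≡⊤) (∣⊤∣≡n n)))))
      F-only : ∀ v → Adj a v × v ∉ F → v ≡ x
      F-only v (_ , v∉F) = [ (λ v∈F → contradiction v∈F v∉F) , id ]′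
        (∈-∪⁅⁆⁻ (subst (v ∈_) (sym F∪x≡⊤) ∈⊤))

  edgeless⇒¬Mixed : Edgeless → ∀ k → ¬ Mixed G k
  edgeless⇒¬Mixed ¬adj k (_ , F , ∣Z∣ , ∣F∣ , ε , ¬F-forces) = ¬F-forces
    (subst (ZeroForcing G) (sym (∣p∣≡n⇒p≡⊤ (trans ∣F∣ (trans (sym ∣Z∣) (∣⊤∣≡n n))))) ε)
  edgeless⇒¬Mixed ¬adj k (_ , _ , _ , _ , force (_ , (uw , _) , _) ◅ _ , _) = ¬adj _ _ uw

  complete⇒≅K : Complete → G ≅ K n
  complete⇒≅K complete = record
    { bijection = ↔-id _
    ; preserves = λ _ _ → mk⇔ (λ { uv refl → irrefl uv }) (complete _ _)
    }

  ≅K⇒complete : ∀ {m} → G ≅ K m → Complete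
  ≅K⇒complete iso x y x≢y =
    Equivalence.from (preserves x y) (x≢y ∘ Injection.injective (Inverse⇒Injection bijection))
    where open _≅_ iso

  ¬adj⇒≅edgeless : Edgeless → G ≅ edgeless n
  ¬adj⇒≅edgeless ¬adj = record
    { bijection = ↔-id _
    ; preserves = λ _ _ → mk⇔ (¬adj _ _) ⊥-elim
    }

  ≅edgeless⇒¬adj : ∀ {m} → G ≅ edgeless m → Edgeless
  ≅edgeless⇒¬adj iso x y = Equivalence.to (_≅_.preserves iso x y)

theorem6 : (n : ℕ) .{{_ : NonZero n}} (G : Graph n) →
    zeroForcingSpan G ≡ 0 ⇔ (G ≅ K n ⊎ G ≅ edgeless n)
theorem6 n G = mk⇔
  (Sum.map (complete⇒≅K G) (¬adj⇒≅edgeless G) ∘ complete-or-edgeless G ∘ span≡0⇒¬Mixed G)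
  (¬Mixed⇒span≡0 G ∘ [ complete⇒¬Mixed G ∘ ≅K⇒complete G , edgeless⇒¬Mixed G ∘ ≅edgeless⇒¬adj G ]′)
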